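{- (1) Any valid term $t$ of $RST$ is $RST$-absolute. (2) If $\varphi$ is a formula of $RST$ and $X$ is a finite set of variables such that $\varphi\succ_{RST}X$, then $\varphi$ is $RST$-absolute for $X$.
   Context: The terms and formulas of $RST$ (Rudimentary Set Theory), and the safety relation $\succ_{RST}$ between formulas and finite sets of variables, are defined by simultaneous recursion over the signature with the binary predicate symbols $\in$ and $=$. $Fv(\cdot)$ denotes the set of free variables of an expression; $\{x\mid\varphi\}$ and $\exists x\varphi$ bind $x$, so $Fv(\{x\mid\varphi\})=Fv(\exists x\varphi)=Fv(\varphi)\setminus\{x\}$. Terms: every variable is a term; if $x$ is a variable and $\varphi$ is a formula such that $\varphi\succ_{RST}\{x\}$, then $\{x\mid\varphi\}$ is a term. Formulas: if $t,s$ are terms then $t=s$ and $t\in s$ are (atomic) formulas; if $\varphi,\psi$ are formulas and $x$ is a variable then $\neg\varphi$, $(\varphi\wedge\psi)$, $(\varphi\vee\psi)$ and $\exists x\varphi$ are formulas. ($\to$, $\leftrightarrow$ and $\forall$ are defined classically from these.) Safety relation: $\succ_{RST}$ is the least relation such that: (1) $\varphi\succ_{RST}\emptyset$ if $\varphi$ is atomic; (2) $\varphi\succ_{RST}\{x\}$ if $\varphi$ is $x\in x$, or $\varphi$ is one of $x=t$, $t=x$, $x\in t$ where $t$ is a term with $x\notin Fv(t)$; (3) $\neg\varphi\succ_{RST}\emptyset$ if $\varphi\succ_{RST}\emptyset$; (4) $\varphi\vee\psi\succ_{RST}X$ if $\varphi\succ_{RST}X$ and $\psi\succ_{RST}X$;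 (5) $\varphi\wedge\psi\succ_{RST}X\cup Y$ if $\varphi\succ_{RST}X$, $\psi\succ_{RST}Y$ and $Y\cap Fv(\varphi)=\emptyset$; (6) $\exists y\varphi\succ_{RST}X\setminus\{y\}$ if $y\in X$ and $\varphi\succ_{RST}X$. Axioms of $RST$ (over classical first-order logic with equality extended to these terms, including $\alpha$-conversion, substitution of equals in any context, and $\forall x(\varphi\leftrightarrow\psi)\to\{x\mid\varphi\}=\{x\mid\psi\}$ for legal terms): Extensionality: $\forall y\,(y=\{x\mid x\in y\})$. Comprehension schema: $\forall x(x\in\{x\mid\varphi\}\leftrightarrow\varphi)$ for every legal term $\{x\mid\varphi\}$. $\in$-induction schema: $(\forall x(\forall y(y\in x\to\varphi[x\mapsto y])\to\varphi))\to\forall x\varphi$, where $\varphi[x\mapsto y]$ is the result of substituting $y$ for the free occurrences of $x$ in $\varphi$. We work in the cumulative universe $V$ of $ZF$, which is a model of $RST$ when $\{x\mid\varphi\}$ is interpreted as the set of all $x$ satisfying $\varphi$. A transitive model of $RST$ is a transitive class $\mathcal M$ which, with the true $\in$ and $=$ and with terms $\{x\mid\varphi\}$ interpreted inside $\mathcal M$ (i.e. as their relativization below, which must belong to $\mathcal M$ for parameters in $\mathcal M$), satisfies the axioms of $RST$. Relativization to a transitive model $\mathcal M$ of $RST$: $t_{\mathcal M}=t$ if $t$ is a variable; $\{x\mid\varphi\}_{\mathcal M}=\{x\mid x\in\mathcal M\wedge\varphi_{\mathcal M}\}$; $(t=s)_{\mathcal M}$ is $t_{\mathcal M}=s_{\mathcal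 M}$; $(t\in s)_{\mathcal M}$ is $t_{\mathcal M}\in s_{\mathcal M}$; $(\neg\varphi)_{\mathcal M}$ is $\neg\varphi_{\mathcal M}$; $(\varphi\vee\psi)_{\mathcal M}$ is $\varphi_{\mathcal M}\vee\psi_{\mathcal M}$; $(\varphi\wedge\psi)_{\mathcal M}$ is $\varphi_{\mathcal M}\wedge\psi_{\mathcal M}$; $(\exists x\varphi)_{\mathcal M}$ is $\exists x(x\in\mathcal M\wedge\varphi_{\mathcal M})$. A term $t$ with $Fv(t)=\{y_1,\ldots,y_n\}$ is $RST$-absolute if for every transitive model $\mathcal M$ of $RST$ the following is true in $V$: $\forall y_1\cdots\forall y_n\,(y_1\in\mathcal M\wedge\cdots\wedge y_n\in\mathcal M\to t_{\mathcal M}=t)$. A formula $\varphi$ with $Fv(\varphi)=\{y_1,\ldots,y_n,x_1,\ldots,x_k\}$ is $RST$-absolute for $\{x_1,\ldots,x_k\}$ if $\{\langle x_1,\ldots,x_k\rangle\mid\varphi\}$ is a set for all values of the parameters $y_1,\ldots,y_n$, and for every transitive model $\mathcal M$ of $RST$ the following is true in $V$ (for all $x_1,\ldots,x_k$ in $V$): $\forall y_1\cdots\forall y_n\,\bigl(y_1\in\mathcal M\wedge\cdots\wedge y_n\in\mathcal M\to[\varphi\leftrightarrow(x_1\in\mathcal M\wedge\cdots\wedge x_k\in\mathcal M\wedge\varphi_{\mathcal M})]\bigr)$. Tuples: $\langle a,b\rangle=\{\{a\},\{a,b\}\}$; $\langle a_1,\ldots,a_m\rangle$ is $\emptyset$ if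 $m=0$, $a_1$ if $m=1$, and $\langle\langle a_1,\ldots,a_{m-1}\rangle,a_m\rangle$ if $m\ge 2$. -}

module Defs where

open import Level using (Level) renaming (suc to lsuc)
open import Data.Empty using () renaming (⊥ to 𝟘)
open import Data.Unit using () renaming (⊤ to 𝟙)
open import Data.Nat.Base using (ℕ; suc)
open import Data.Fin.Base using (Fin; zero; suc; lift)
open import Data.Fin.Subset using (Subset; ⁅_⁆; _∈_; _∉_; _⊆_; _∪_; _∩_; Empty)
  renaming (⊥ to ∅)
open import Data.List.Base as List using (List; []; _∷_)
open import Data.List.Membership.Propositional using () renaming (_∈_ to _∈ₗ_)
open import Data.List.Relation.Unary.Unique.Propositional using (Unique)
open import Data.Product.Base using (∃; _×_; proj₁)
open import Data.Sum.Base using (_⊎_)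
open import Data.Vec.Base as Vec using ()
open import Data.Vec.Functional using (Vector) renaming (_∷_ to _▹_)
open import Function.Bundles using (_⇔_)
open import Relation.Binary.Core using (Rel)
open import Relation.Binary.PropositionalEquality.Core using (_≡_)
open import Relation.Nullary.Negation.Core using (¬_)
open import Relation.Unary using (Pred; _≐_)

infix  7 _=̇_ _∈̇_
infix  8 ¬̇_
infixr 6 _∧̇_
infixr 5 _∨̇_

------------------------------------------------------------------------
-- Syntax of RST

-- Variables are well-scoped de Bruijn indices, so α-equivalent expressions
-- are identical. All abstracts ｛ φ ｝ are allowed here; the safety condition
-- is imposed by ValidTerm / ValidFormula. C is a set of class symbols: it is
-- empty for the language of RST, and a singleton (naming the model) for
-- relativized expressions.

mutual
  data Term (C : Set) (n : ℕ) : Set where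
    var  : Fin n → Term C n
    ｛_｝ : Formula C (suc n) → Term C n

  data Formula (C : Set) (n : ℕ) : Set where
    _=̇_ _∈̇_ : Term C n → Term C n → Formula C n
    _∈ᶜ_     : Fin n → C → Formula C n
    ¬̇_       : Formula C n → Formula C n
    _∧̇_ _∨̇_ : Formula C n → Formula C n → Formula C n
    ∃̇_       : Formula C (suc n) → Formula C n

module _ {C : Set} where

  infixr 4 _⇒̇_
  infix  3 _⇔̇_

  _⇒̇_ _⇔̇_ : ∀ {n} → Formula C n → Formula C n → Formula C n
  φ ⇒̇ ψ = ¬̇ φ ∨̇ ψ
  φ ⇔̇ ψ = (φ ⇒̇ ψ) ∧̇ (ψ ⇒̇ φ)

  ∀̇_ : ∀ {n} → Formula C (suc n) → Formula C n
  ∀̇ φ = ¬̇ (∃̇ (¬̇ φ))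

  mutual
    FvTerm : ∀ {n} → Term C n → Subset n
    FvTerm (var x)  = ⁅ x ⁆
    FvTerm ｛ φ ｝   = Vec.tail (Fv φ)

    Fv : ∀ {n} → Formula C n → Subset n
    Fv (t =̇ s)  = FvTerm t ∪ FvTerm s
    Fv (t ∈̇ s)  = FvTerm t ∪ FvTerm s
    Fv (x ∈ᶜ _) = ⁅ x ⁆
    Fv (¬̇ φ)    = Fv φ
    Fv (φ ∧̇ ψ)  = Fv φ ∪ Fv ψ
    Fv (φ ∨̇ ψ)  = Fv φ ∪ Fv ψ
    Fv (∃̇ φ)    = Vec.tail (Fv φ)

  mutual
    renameTerm : ∀ {m n} → (Fin m → Fin n) → Term C m → Term C n
    renameTerm f (var x) = var (f x)
    renameTerm f ｛ φ ｝  = ｛ rename (lift 1 f) φ ｝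

    rename : ∀ {m n} → (Fin m → Fin n) → Formula C m → Formula C n
    rename f (t =̇ s)  = renameTerm f t =̇ renameTerm f s
    rename f (t ∈̇ s)  = renameTerm f t ∈̇ renameTerm f s
    rename f (x ∈ᶜ c) = f x ∈ᶜ c
    rename f (¬̇ φ)    = ¬̇ rename f φ
    rename f (φ ∧̇ ψ)  = rename f φ ∧̇ rename f ψ
    rename f (φ ∨̇ ψ)  = rename f φ ∨̇ rename f ψ
    rename f (∃̇ φ)    = ∃̇ rename (lift 1 f) φ

RSTTerm RSTFormula : ℕ → Set
RSTTerm    = Term 𝟘
RSTFormula = Formula 𝟘

infix 2 _≻_

mutual
  data ValidTerm {n} : RSTTerm n → Set where
    var  : ∀ x → ValidTerm (var x)
    ｛_｝ : ∀ {φ} → φ ≻ ⁅ zero ⁆ → ValidTerm ｛ φ ｝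

  data ValidFormula {n} : RSTFormula n → Set where
    _=̇_ : ∀ {t s} → ValidTerm t → ValidTerm s → ValidFormula (t =̇ s)
    _∈̇_ : ∀ {t s} → ValidTerm t → ValidTerm s → ValidFormula (t ∈̇ s)
    ¬̇_  : ∀ {φ} → ValidFormula φ → ValidFormula (¬̇ φ)
    _∧̇_ : ∀ {φ ψ} → ValidFormula φ → ValidFormula ψ → ValidFormula (φ ∧̇ ψ)
    _∨̇_ : ∀ {φ ψ} → ValidFormula φ → ValidFormula ψ → ValidFormula (φ ∨̇ ψ)
    ∃̇_  : ∀ {φ} → ValidFormula φ → ValidFormula (∃̇ φ)

  -- Only valid formulas are safe for anything: the premises on terms below
  -- propagate validity from the atomic formulas.
  data _≻_ {n} : RSTFormula n → Subset n → Set where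
    atom-= : ∀ {t s} → ValidTerm t → ValidTerm s → t =̇ s ≻ ∅
    atom-∈ : ∀ {t s} → ValidTerm t → ValidTerm s → t ∈̇ s ≻ ∅
    self-∈ : ∀ {x} → var x ∈̇ var x ≻ ⁅ x ⁆
    var-=  : ∀ {x t} → ValidTerm t → x ∉ FvTerm t → var x =̇ t ≻ ⁅ x ⁆
    =-var  : ∀ {x t} → ValidTerm t → x ∉ FvTerm t → t =̇ var x ≻ ⁅ x ⁆
    var-∈  : ∀ {x t} → ValidTerm t → x ∉ FvTerm t → var x ∈̇ t ≻ ⁅ x ⁆
    neg    : ∀ {φ} → φ ≻ ∅ → ¬̇ φ ≻ ∅
    or     : ∀ {φ ψ X} → φ ≻ X → ψ ≻ X → φ ∨̇ ψ ≻ X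
    and    : ∀ {φ ψ X Y} → φ ≻ X → ψ ≻ Y → Empty (Y ∩ Fv φ) → φ ∧̇ ψ ≻ X ∪ Y
    ex     : ∀ {φ X} → zero ∈ X → φ ≻ X → ∃̇ φ ≻ Vec.tail X

-- Under the binder that instantiates it, ｛ φ ｝ itself has to be weakened;
-- rename (lift 1 suc) φ is also φ[x ↦ y] in the context y, x, ….
data Axiom {n} : RSTFormula n → Set where
  extensionality : Axiom (∀̇ (var zero =̇ ｛ var zero ∈̇ var (suc zero) ｝))
  comprehension  : ∀ {φ} → ValidTerm ｛ φ ｝ →
                   Axiom (∀̇ (var zero ∈̇ renameTerm suc ｛ φ ｝ ⇔̇ φ))
  ∈-induction    : ∀ {φ} → ValidFormula φ →
                   Axiom ((∀̇ ((∀̇ (var zero ∈̇ var (suc zero) ⇒̇ rename (lift 1 suc) φ)) ⇒̇ φ))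
                          ⇒̇ ∀̇ φ)

------------------------------------------------------------------------
-- Relativization

mutual
  relTerm : ∀ {n} → RSTTerm n → Term 𝟙 n
  relTerm (var x) = var x
  relTerm ｛ φ ｝  = ｛ zero ∈ᶜ _ ∧̇ rel φ ｝

  rel : ∀ {n} → RSTFormula n → Formula 𝟙 n
  rel (t =̇ s) = relTerm t =̇ relTerm s
  rel (t ∈̇ s) = relTerm t ∈̇ relTerm s
  rel (¬̇ φ)   = ¬̇ rel φ
  rel (φ ∧̇ ψ) = rel φ ∧̇ rel ψ
  rel (φ ∨̇ ψ) = rel φ ∨̇ rel ψ
  rel (∃̇ φ)   = ∃̇ (zero ∈ᶜ _ ∧̇ rel φ)

------------------------------------------------------------------------
-- Models of ZF

-- First-order formulas over ∈ and =, without class abstracts; these are the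
-- formulas of the Separation and Replacement schemas.
data ∈Formula (n : ℕ) : Set where
  _=̇_ _∈̇_ : Fin n → Fin n → ∈Formula n
  ¬̇_       : ∈Formula n → ∈Formula n
  _∧̇_ _∨̇_ : ∈Formula n → ∈Formula n → ∈Formula n
  ∃̇_       : ∈Formula (suc n) → ∈Formula n

module Satisfaction {ℓ : Level} {V : Set ℓ} (_ε_ : Rel V ℓ) where

  Sat : ∀ {n} → ∈Formula n → Vector V n → Set ℓ
  Sat (x =̇ y) ρ = ρ x ≡ ρ y
  Sat (x ∈̇ y) ρ = ρ x ε ρ y
  Sat (¬̇ φ)   ρ = ¬ Sat φ ρ
  Sat (φ ∧̇ ψ) ρ = Sat φ ρ × Sat ψ ρ
  Sat (φ ∨̇ ψ) ρ = Sat φ ρ ⊎ Sat ψ ρ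
  Sat (∃̇ φ)   ρ = ∃ λ a → Sat φ (a ▹ ρ)

record ZFModel (ℓ : Level) : Set (lsuc ℓ) where
  infix 4 _ε_
  field
    V   : Set ℓ
    _ε_ : Rel V ℓ

  open Satisfaction _ε_ public

  field
    ext         : ∀ {a b} → (∀ z → z ε a ⇔ z ε b) → a ≡ b
    foundation  : ∀ a → (∃ λ b → b ε a) →
                  ∃ λ b → b ε a × (∀ z → z ε a → ¬ z ε b)
    empty       : ∃ λ e → ∀ z → ¬ z ε e
    pairing     : ∀ a b → ∃ λ c → ∀ z → z ε c ⇔ (z ≡ a ⊎ z ≡ b)
    union       : ∀ a → ∃ λ u → ∀ z → z ε u ⇔ (∃ λ b → b ε a × z ε b)
    powerset    : ∀ a → ∃ λ p → ∀ z → z ε p ⇔ (∀ w → w ε z → w ε a)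
    infinity    : ∃ λ w → proj₁ empty ε w ×
                  (∀ x → x ε w → ∃ λ y → y ε w × (∀ z → z ε y ⇔ (z ε x ⊎ z ≡ x)))
    separation  : ∀ {n} (φ : ∈Formula (suc n)) (ρ : Vector V n) a →
                  ∃ λ b → ∀ z → z ε b ⇔ (z ε a × Sat φ (z ▹ ρ))
    replacement : ∀ {n} (φ : ∈Formula (suc (suc n))) (ρ : Vector V n) a →
                  (∀ x y y′ → x ε a → Sat φ (x ▹ y ▹ ρ) → Sat φ (x ▹ y′ ▹ ρ) → y ≡ y′) →
                  ∃ λ b → ∀ y → y ε b ⇔ (∃ λ x → x ε a × Sat φ (x ▹ y ▹ ρ))

  -- ⟨a , b⟩ = {{a} , {a , b}} and ⟨a₁ , … , aₘ⟩ = ⟨⟨a₁ , … , aₘ₋₁⟩ , aₘ⟩.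
  upair opair : V → V → V
  upair a b = proj₁ (pairing a b)
  opair a b = upair (upair a a) (upair a b)

  tuple : List V → V
  tuple []       = proj₁ empty
  tuple (a ∷ as) = List.foldl opair a as

  IsSet : Pred V ℓ → Set ℓ
  IsSet P = ∃ λ a → (_ε a) ≐ P

  -- Terms denote classes, a set a being identified with the class (_ε a):
  -- equality is coextensionality, and t ∈ s says that t is a set which
  -- belongs to s. I interprets the class symbols.
  module _ {C : Set} (I : C → Pred V ℓ) where
    mutual
      ⟦_⟧ₜ : ∀ {n} → Term C n → Vector V n → Pred V ℓ
      ⟦ var x ⟧ₜ ρ z = z ε ρ x
      ⟦ ｛ φ ｝ ⟧ₜ ρ z = ⟦ φ ⟧ (z ▹ ρ)

      ⟦_⟧ : ∀ {n} → Formula C n → Vector V n → Set ℓ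
      ⟦ t =̇ s ⟧  ρ = ⟦ t ⟧ₜ ρ ≐ ⟦ s ⟧ₜ ρ
      ⟦ t ∈̇ s ⟧  ρ = ∃ λ a → (_ε a) ≐ ⟦ t ⟧ₜ ρ × ⟦ s ⟧ₜ ρ a
      ⟦ x ∈ᶜ c ⟧ ρ = I c (ρ x)
      ⟦ ¬̇ φ ⟧    ρ = ¬ ⟦ φ ⟧ ρ
      ⟦ φ ∧̇ ψ ⟧  ρ = ⟦ φ ⟧ ρ × ⟦ ψ ⟧ ρ
      ⟦ φ ∨̇ ψ ⟧  ρ = ⟦ φ ⟧ ρ ⊎ ⟦ ψ ⟧ ρ
      ⟦ ∃̇ φ ⟧    ρ = ∃ λ a → ⟦ φ ⟧ (a ▹ ρ)

  RST⟦_⟧ₜ : ∀ {n} → RSTTerm n → Vector V n → Pred V ℓ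
  RST⟦_⟧ₜ = ⟦_⟧ₜ (λ ())

  RST⟦_⟧ : ∀ {n} → RSTFormula n → Vector V n → Set ℓ
  RST⟦_⟧ = ⟦_⟧ (λ ())

  -- Classes are definable with parameters.
  record Class : Set ℓ where
    field
      {arity}  : ℕ
      formula  : ∈Formula (suc arity)
      params   : Vector V arity

  _ε̂_ : V → Class → Set ℓ
  a ε̂ M = Sat (Class.formula M) (a ▹ Class.params M)

  Rel⟦_⟧ₜ : ∀ {n} → RSTTerm n → Class → Vector V n → Pred V ℓ
  Rel⟦ t ⟧ₜ M = ⟦_⟧ₜ (λ _ → _ε̂ M) (relTerm t)

  Rel⟦_⟧ : ∀ {n} → RSTFormula n → Class → Vector V n → Set ℓ
  Rel⟦ φ ⟧ M = ⟦_⟧ (λ _ → _ε̂ M) (rel φ)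

  record TransitiveModel (M : Class) : Set ℓ where
    field
      transitive : ∀ {a b} → a ε̂ M → b ε a → b ε̂ M
      closed     : ∀ {n} {t : RSTTerm n} → ValidTerm t →
                   ∀ ρ → (∀ x → x ∈ FvTerm t → ρ x ε̂ M) →
                   ∃ λ a → a ε̂ M × (_ε a) ≐ Rel⟦ t ⟧ₜ M ρ
      axioms     : ∀ {n} {φ : RSTFormula n} → Axiom φ →
                   ∀ ρ → (∀ x → x ∈ Fv φ → ρ x ε̂ M) → Rel⟦ φ ⟧ M ρ

  AbsoluteTerm : ∀ {n} → RSTTerm n → Set ℓ
  AbsoluteTerm t =
    ∀ M → TransitiveModel M →
    ∀ ρ → (∀ y → y ∈ FvTerm t → ρ y ε̂ M) → Rel⟦ t ⟧ₜ M ρ ≐ RST⟦ t ⟧ₜ ρ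

  Enumerates : ∀ {n} → List (Fin n) → Subset n → Set
  Enumerates xs X = Unique xs × (∀ x → x ∈ X ⇔ x ∈ₗ xs)

  -- {⟨x₁ , … , xₖ⟩ | φ}, the variables other than x₁ , … , xₖ being
  -- parameters with values given by ρ.
  Tuples : ∀ {n} → RSTFormula n → List (Fin n) → Vector V n → Pred V ℓ
  Tuples φ xs ρ z =
    ∃ λ σ → (∀ y → ¬ y ∈ₗ xs → σ y ≡ ρ y) × RST⟦ φ ⟧ σ × z ≡ tuple (List.map σ xs)

  record AbsoluteFor {n} (φ : RSTFormula n) (X : Subset n) : Set ℓ where
    field
      free     : X ⊆ Fv φ
      isSet    : ∀ xs → Enumerates xs X → ∀ ρ → IsSet (Tuples φ xs ρ)
      absolute : ∀ M → TransitiveModel M →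
                 ∀ ρ → (∀ y → y ∈ Fv φ → y ∉ X → ρ y ε̂ M) →
                 RST⟦ φ ⟧ ρ ⇔ ((∀ x → x ∈ X → ρ x ε̂ M) × Rel⟦ φ ⟧ M ρ)

{-# OPTIONS --safe #-}

-- Absoluteness itself is a direct induction on φ ≻ X. For the existence of the
-- set of tuples, call a definable relation P between sets v and environments ρ
-- a family if {v | P v ρ} is a set for every ρ. The invariant, proved by
-- induction on φ ≻ X, is that
--   {v | ∃ τ, τ = ρ outside X, φ holds at τ, and P v τ}
-- is again a family whenever P is one. Conjunction then amounts to composing
-- the two operations, and the only use of Replacement is a single variable
-- ranging over a set. Taking for P the graph of τ ↦ ⟨τ x₁ , … , τ xₖ⟩ gives
-- the set of tuples.

module Submission where

open import Defs
open import Level using (Level) renaming (suc to lsuc)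
open import Axiom.ExcludedMiddle using (ExcludedMiddle)
open import Data.Empty using (⊥-elim)
open import Data.Nat.Base using (ℕ; suc)
open import Data.Fin.Base using (Fin; zero; suc; lift)
open import Data.Fin.Properties using (_≟_)
open import Data.Fin.Subset using (Subset; ⁅_⁆; _∈_; _∉_; _⊆_; _∪_; _∩_; Empty)
  renaming (⊥ to ∅)
open import Data.Fin.Subset.Properties
  using (_∈?_; ∉⊥; x∈⁅x⁆; x∈⁅y⁆⇒x≡y; x∈p∪q⁻; x∈p∪q⁺; x∈p∩q⁺; drop-there)
open import Data.List.Base as List using (List; []; _∷_)
open import Data.Product.Base as Prod using (∃; _×_; _,_; proj₁; proj₂; map₂)
open import Data.Sum.Base as Sum using (_⊎_; inj₁; inj₂; [_,_])
open import Data.Vec.Base as Vec using (there)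
open import Data.Vec.Functional using (Vector; head; tail) renaming (_∷_ to _▹_)
open import Function.Base using (_∘_; id)
open import Function.Bundles using (_⇔_; mk⇔; module Equivalence)
open import Relation.Binary.PropositionalEquality
  using (_≡_; _≢_; _≗_; refl; sym; trans; cong; subst; subst₂)
open import Relation.Nullary.Decidable.Core using (yes; no; decidable-stable)
open import Relation.Nullary.Negation.Core using (¬_)
open import Relation.Unary using (Pred; _≐_)

open Equivalence using (to; from)

-- Sets of free variables

∈-tail⁺ : ∀ {n x} {p : Subset (suc n)} → suc x ∈ p → x ∈ Vec.tail p
∈-tail⁺ {p = _ Vec.∷ _} = drop-there

∈-tail⁻ : ∀ {n x} {p : Subset (suc n)} → x ∈ Vec.tail p → suc x ∈ p
∈-tail⁻ {p = _ Vec.∷ _} = there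

∪⁺ˡ : ∀ {n x} (p q : Subset n) → x ∈ p → x ∈ p ∪ q
∪⁺ˡ p q = x∈p∪q⁺ {p = p} {q = q} ∘ inj₁

∪⁺ʳ : ∀ {n x} (p q : Subset n) → x ∈ q → x ∈ p ∪ q
∪⁺ʳ p q = x∈p∪q⁺ {p = p} {q = q} ∘ inj₂

-- Every clause that makes a variable safe has that variable free in the formula, and binding one
-- removes the same index from both sides.
≻⇒⊆Fv : ∀ {n} {φ : RSTFormula n} {X} → φ ≻ X → X ⊆ Fv φ
≻⇒⊆Fv (atom-= _ _) x∈ = ⊥-elim (∉⊥ x∈)
≻⇒⊆Fv (atom-∈ _ _) x∈ = ⊥-elim (∉⊥ x∈)
≻⇒⊆Fv (self-∈ {x}) x∈ = ∪⁺ˡ ⁅ x ⁆ ⁅ x ⁆ x∈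
≻⇒⊆Fv (var-= {x} {t} _ _) x∈ = ∪⁺ˡ ⁅ x ⁆ (FvTerm t) x∈
≻⇒⊆Fv (=-var {x} {t} _ _) x∈ = ∪⁺ʳ (FvTerm t) ⁅ x ⁆ x∈
≻⇒⊆Fv (var-∈ {x} {t} _ _) x∈ = ∪⁺ˡ ⁅ x ⁆ (FvTerm t) x∈
≻⇒⊆Fv (neg _) x∈ = ⊥-elim (∉⊥ x∈)
≻⇒⊆Fv (or {φ} {ψ} p q) x∈ = ∪⁺ˡ (Fv φ) (Fv ψ) (≻⇒⊆Fv p x∈)
≻⇒⊆Fv (and {φ} {ψ} {X} {Y} p q _) x∈ with x∈p∪q⁻ X Y x∈
... | inj₁ x∈X = ∪⁺ˡ (Fv φ) (Fv ψ) (≻⇒⊆Fv p x∈X)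
... | inj₂ x∈Y = ∪⁺ʳ (Fv φ) (Fv ψ) (≻⇒⊆Fv q x∈Y)
≻⇒⊆Fv (ex _ p) x∈ = ∈-tail⁺ (≻⇒⊆Fv p (∈-tail⁻ x∈))

-- Environments, renamings and updates

▹-cong : ∀ {a} {A : Set a} {m n} {x : A} {ρ : Vector A m} {ρ′ : Vector A n} {f} →
         (∀ i → ρ i ≡ ρ′ (f i)) → ∀ i → (x ▹ ρ) i ≡ (x ▹ ρ′) (lift 1 f i)
▹-cong eq zero    = refl
▹-cong eq (suc i) = eq i

renameᶻ : ∀ {m n} → (Fin m → Fin n) → ∈Formula m → ∈Formula n
renameᶻ f (x =̇ y) = f x =̇ f y
renameᶻ f (x ∈̇ y) = f x ∈̇ f y
renameᶻ f (¬̇ φ)   = ¬̇ renameᶻ f φ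
renameᶻ f (φ ∧̇ ψ) = renameᶻ f φ ∧̇ renameᶻ f ψ
renameᶻ f (φ ∨̇ ψ) = renameᶻ f φ ∨̇ renameᶻ f ψ
renameᶻ f (∃̇ φ)   = ∃̇ renameᶻ (lift 1 f) φ

infix 4 _≈[_]_

_≈[_]_ : ∀ {a} {A : Set a} {n} → Vector A n → Subset n → Vector A n → Set a
τ ≈[ X ] ρ = ∀ y → y ∉ X → τ y ≡ ρ y

-- The intermediate environment for conjunction: a change of ρ on X ∪ Y is split into a change on X
-- followed by a change on Y.
splice : ∀ {a} {A : Set a} {n} → Subset n → Vector A n → Vector A n → Vector A n
splice X τ ρ i with i ∈? X
... | yes _ = τ i
... | no  _ = ρ i

splice-≈ : ∀ {a} {A : Set a} {n} X (τ ρ : Vector A n) → splice X τ ρ ≈[ X ] ρ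
splice-≈ X τ ρ i i∉X with i ∈? X
... | yes i∈X = ⊥-elim (i∉X i∈X)
... | no  _   = refl

splice-∪ : ∀ {a} {A : Set a} {n} X Y (τ ρ : Vector A n) → τ ≈[ X ∪ Y ] ρ →
           τ ≈[ Y ] splice X τ ρ
splice-∪ X Y τ ρ eq i i∉Y with i ∈? X
... | yes _   = refl
... | no  i∉X = eq i λ i∈ → [ i∉X , i∉Y ] (x∈p∪q⁻ X Y i∈)

-- Makes an update at x a renaming: `ρ [ x ≔ a ]` is `a ▹ ρ` read through `assign x`, so
-- definability passes to updated environments by `renameᵈ`.
assign : ∀ {n} → Fin n → Fin n → Fin (suc n)
assign x i with i ≟ x
... | yes _ = zero
... | no  _ = suc i

infixl 6 _[_≔_]

_[_≔_] : ∀ {a} {A : Set a} {n} → Vector A n → Fin n → A → Vector A n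
(ρ [ x ≔ a ]) i = (a ▹ ρ) (assign x i)

≔-updates : ∀ {a} {A : Set a} {n} (ρ : Vector A n) x c → (ρ [ x ≔ c ]) x ≡ c
≔-updates ρ x c with x ≟ x
... | yes _   = refl
... | no  x≢x = ⊥-elim (x≢x refl)

≔-minimal : ∀ {a} {A : Set a} {n} (ρ : Vector A n) {x i} c → i ≢ x →
            (ρ [ x ≔ c ]) i ≡ ρ i
≔-minimal ρ {x} {i} c i≢x with i ≟ x
... | yes i≡x = ⊥-elim (i≢x i≡x)
... | no  _   = refl

-- Turns a quantifier over environments that vary only at x into a quantifier over the single value
-- of x.
≈⁅⁆⇒≔ : ∀ {a} {A : Set a} {n} {τ ρ : Vector A n} x → τ ≈[ ⁅ x ⁆ ] ρ → τ ≗ ρ [ x ≔ τ x ]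
≈⁅⁆⇒≔ {τ = τ} {ρ} x eq i with i ≟ x
... | yes i≡x = cong τ i≡x
... | no  i≢x = eq i λ i∈ → i≢x (x∈⁅y⁆⇒x≡y _ i∈)

module _ {ℓ : Level} (em : ExcludedMiddle ℓ) (𝔙 : ZFModel ℓ) where
  open ZFModel 𝔙

  -- Coextensionality and foundation

  ≐⇒≡ : ∀ {a b} → (_ε a) ≐ (_ε b) → a ≡ b
  ≐⇒≡ (p , q) = ext λ _ → mk⇔ p q

  ≡⇒≐ : ∀ {a b} → a ≡ b → (_ε a) ≐ (_ε b)
  ≡⇒≐ refl = id , id

  ≐-sym : {P Q : Pred V ℓ} → P ≐ Q → Q ≐ P
  ≐-sym (p , q) = q , p

  ≐-trans : {P Q R : Pred V ℓ} → P ≐ Q → Q ≐ R → P ≐ R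
  ≐-trans (p , q) (p′ , q′) = (λ x → p′ (p x)) , (λ x → q (q′ x))

  -- Foundation for {a} gives a member of {a} disjoint from it. That member is a, and a ∈ a would
  -- put a in both.
  ε-irrefl : ∀ a → ¬ a ε a
  ε-irrefl a a∈a with proj₂ (pairing a a)
  ... | pair with foundation _ (a , from (pair a) (inj₁ refl))
  ... | b , b∈ , disj = disj a (from (pair a) (inj₁ refl)) (subst (a ε_) (sym b≡a) a∈a)
    where
    b≡a : b ≡ a
    b≡a = [ id , id ] (to (pair b) b∈)

  -- Dependence on free variables only

  module _ {C : Set} (I : C → Pred V ℓ) where

    AgreeOn : ∀ {n} → Subset n → Vector V n → Vector V n → Set ℓ
    AgreeOn X ρ ρ′ = ∀ i → i ∈ X → ρ i ≡ ρ′ i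

    agree-sym : ∀ {n} {X : Subset n} {ρ ρ′} → AgreeOn X ρ ρ′ → AgreeOn X ρ′ ρ
    agree-sym eq i i∈ = sym (eq i i∈)

    agree-▹ : ∀ {n} {X : Subset (suc n)} {ρ ρ′ a} →
              AgreeOn (Vec.tail X) ρ ρ′ → AgreeOn X (a ▹ ρ) (a ▹ ρ′)
    agree-▹ eq zero    _  = refl
    agree-▹ eq (suc i) i∈ = eq i (∈-tail⁺ i∈)

    agreeˡ : ∀ {n} (X Y : Subset n) {ρ ρ′} → AgreeOn (X ∪ Y) ρ ρ′ → AgreeOn X ρ ρ′
    agreeˡ X Y eq i i∈ = eq i (∪⁺ˡ X Y i∈)

    agreeʳ : ∀ {n} (X Y : Subset n) {ρ ρ′} → AgreeOn (X ∪ Y) ρ ρ′ → AgreeOn Y ρ ρ′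
    agreeʳ X Y eq i i∈ = eq i (∪⁺ʳ X Y i∈)

    mutual
      coincidenceₜ : ∀ {n} (t : Term C n) {ρ ρ′ : Vector V n} →
                     AgreeOn (FvTerm t) ρ ρ′ → ⟦_⟧ₜ I t ρ ≐ ⟦_⟧ₜ I t ρ′
      coincidenceₜ (var x) eq = ≡⇒≐ (eq x (x∈⁅x⁆ x))
      coincidenceₜ ｛ φ ｝ eq =
        coincidence φ (agree-▹ eq) , coincidence φ (agree-▹ (agree-sym eq))

      -- One direction is enough: agreement is symmetric, so negations and abstracts obtain the
      -- converse by exchanging the environments.
      coincidence : ∀ {n} (φ : Formula C n) {ρ ρ′ : Vector V n} →
                    AgreeOn (Fv φ) ρ ρ′ → ⟦_⟧ I φ ρ → ⟦_⟧ I φ ρ′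
      coincidence (t =̇ s) eq p =
        ≐-trans (≐-sym (coincidenceₜ t (agreeˡ (FvTerm t) (FvTerm s) eq)))
          (≐-trans p (coincidenceₜ s (agreeʳ (FvTerm t) (FvTerm s) eq)))
      coincidence (t ∈̇ s) eq (a , a≐t , a∈s) =
        a , ≐-trans a≐t (coincidenceₜ t (agreeˡ (FvTerm t) (FvTerm s) eq)) ,
        proj₁ (coincidenceₜ s (agreeʳ (FvTerm t) (FvTerm s) eq)) a∈s
      coincidence (x ∈ᶜ c) eq p = subst (I c) (eq x (x∈⁅x⁆ x)) p
      coincidence (¬̇ φ) eq p q = p (coincidence φ (agree-sym eq) q)
      coincidence (φ ∧̇ ψ) eq (p , q) =
        coincidence φ (agreeˡ (Fv φ) (Fv ψ) eq) p , coincidence ψ (agreeʳ (Fv φ) (Fv ψ) eq) q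
      coincidence (φ ∨̇ ψ) eq =
        Sum.map (coincidence φ (agreeˡ (Fv φ) (Fv ψ) eq))
                (coincidence ψ (agreeʳ (Fv φ) (Fv ψ) eq))
      coincidence (∃̇ φ) eq (a , p) = a , coincidence φ (agree-▹ eq) p

  ⟦⟧-resp-≗ : ∀ {n} (φ : RSTFormula n) {ρ ρ′ : Vector V n} → ρ ≗ ρ′ → RST⟦ φ ⟧ ρ → RST⟦ φ ⟧ ρ′
  ⟦⟧-resp-≗ φ eq = coincidence (λ ()) φ λ i _ → eq i

  -- Absoluteness

  module _ {M : Class} (𝔐 : TransitiveModel M) where
    open TransitiveModel 𝔐

    _In_ : ∀ {n} → Vector V n → Subset n → Set ℓ
    ρ In X = ∀ x → x ∈ X → ρ x ε̂ M

    AbsoluteAt : ∀ {n} → RSTFormula n → Subset n → Vector V n → Set ℓ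
    AbsoluteAt φ X ρ = RST⟦ φ ⟧ ρ ⇔ (ρ In X × Rel⟦ φ ⟧ M ρ)

    vacuous : ∀ {n} {ρ : Vector V n} → ρ In ∅
    vacuous x x∈ = ⊥-elim (∉⊥ x∈)

    in-⁅⁆ : ∀ {n} {ρ : Vector V n} {x} → ρ x ε̂ M → ρ In ⁅ x ⁆
    in-⁅⁆ {ρ = ρ} ρx∈M y y∈ = subst (λ z → ρ z ε̂ M) (sym (x∈⁅y⁆⇒x≡y _ y∈)) ρx∈M

    ParamsIn : ∀ {n} → RSTFormula n → Subset n → Vector V n → Set ℓ
    ParamsIn φ X ρ = ∀ y → y ∈ Fv φ → y ∉ X → ρ y ε̂ M

    ∉⇒∉⁅⁆ : ∀ {n} {x y : Fin n} {X : Subset n} → x ∉ X → y ∈ X → y ∉ ⁅ x ⁆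
    ∉⇒∉⁅⁆ {X = X} x∉X y∈X y∈ = x∉X (subst (_∈ X) (x∈⁅y⁆⇒x≡y _ y∈) y∈X)

    -- The bound variable lies in X and so is not a parameter; its value a may be any element of V,
    -- inside M or not.
    params-▹ : ∀ {n} {φ : RSTFormula (suc n)} {X ρ a} → zero ∈ X →
               (∀ y → y ∈ Vec.tail (Fv φ) → y ∉ Vec.tail X → ρ y ε̂ M) →
               ParamsIn φ X (a ▹ ρ)
    params-▹ 0∈X h zero    _  0∉ = ⊥-elim (0∉ 0∈X)
    params-▹ 0∈X h (suc y) y∈ y∉ = h y (∈-tail⁺ y∈) λ y∈X → y∉ (∈-tail⁻ y∈X)

    module _ {n} {t s : RSTTerm n} {ρ}
             (e : Rel⟦ t ⟧ₜ M ρ ≐ RST⟦ t ⟧ₜ ρ) (f : Rel⟦ s ⟧ₜ M ρ ≐ RST⟦ s ⟧ₜ ρ) where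

      absolute-= : RST⟦ t =̇ s ⟧ ρ ⇔ Rel⟦ t =̇ s ⟧ M ρ
      absolute-= = mk⇔ (λ p → ≐-trans e (≐-trans p (≐-sym f)))
                       (λ p → ≐-trans (≐-sym e) (≐-trans p f))

      absolute-∈ : RST⟦ t ∈̇ s ⟧ ρ ⇔ Rel⟦ t ∈̇ s ⟧ M ρ
      absolute-∈ = mk⇔ (λ (a , p , q) → a , ≐-trans p (≐-sym e) , proj₂ f q)
                       (λ (a , p , q) → a , ≐-trans p e , proj₁ f q)

    mutual
      -- For an abstract, absoluteness of the body for its bound variable says that every solution
      -- in V already lies in M and satisfies the relativized body, which is membership in the
      -- relativized abstract.
      absoluteₜ : ∀ {n} {t : RSTTerm n} → ValidTerm t → ∀ ρ → ρ In FvTerm t →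
                  Rel⟦ t ⟧ₜ M ρ ≐ RST⟦ t ⟧ₜ ρ
      absoluteₜ (var x) ρ h = id , id
      absoluteₜ (｛_｝ {φ} p) ρ h =
        (λ {z} (z∈M , q) → from (abs z) (in-⁅⁆ {ρ = z ▹ ρ} {zero} z∈M , q)) ,
        (λ {z} q → let (z∈M , r) = to (abs z) q in z∈M zero (x∈⁅x⁆ {suc _} zero) , r)
        where
        abs : ∀ z → AbsoluteAt φ ⁅ zero ⁆ (z ▹ ρ)
        abs z = absolute p (z ▹ ρ) (params-▹ {φ = φ} (x∈⁅x⁆ zero) λ y y∈ _ → h y y∈)

      -- M contains the relativized value of t by closure; absoluteness of t and extensionality
      -- identify it with a.
      value-in : ∀ {n} {t : RSTTerm n} → ValidTerm t → ∀ ρ → ρ In FvTerm t →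
                 ∀ {a} → (_ε a) ≐ RST⟦ t ⟧ₜ ρ → a ε̂ M
      value-in v ρ h a≐t with closed v ρ h
      ... | b , b∈M , b≐t =
        subst (_ε̂ M) (≐⇒≡ (≐-trans b≐t (≐-trans (absoluteₜ v ρ h) (≐-sym a≐t)))) b∈M

      -- The value of t is an element of M, so transitivity brings its members into M.
      member-in : ∀ {n} {t : RSTTerm n} → ValidTerm t → ∀ ρ → ρ In FvTerm t →
                  ∀ {a} → RST⟦ t ⟧ₜ ρ a → a ε̂ M
      member-in v ρ h a∈t with closed v ρ h
      ... | b , b∈M , b≐t = transitive b∈M (proj₂ b≐t (proj₂ (absoluteₜ v ρ h) a∈t))

      absolute : ∀ {n} {φ : RSTFormula n} {X} → φ ≻ X → ∀ ρ → ParamsIn φ X ρ →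
                 AbsoluteAt φ X ρ
      absolute (atom-= {t} {s} v w) ρ h =
        mk⇔ (λ p → vacuous , to abs p) (λ (_ , p) → from abs p)
        where abs = absolute-= {t = t} {s}
                (absoluteₜ v ρ λ y y∈ → h y (∪⁺ˡ (FvTerm t) (FvTerm s) y∈) ∉⊥)
                (absoluteₜ w ρ λ y y∈ → h y (∪⁺ʳ (FvTerm t) (FvTerm s) y∈) ∉⊥)
      absolute (atom-∈ {t} {s} v w) ρ h =
        mk⇔ (λ p → vacuous , to abs p) (λ (_ , p) → from abs p)
        where abs = absolute-∈ {t = t} {s}
                (absoluteₜ v ρ λ y y∈ → h y (∪⁺ˡ (FvTerm t) (FvTerm s) y∈) ∉⊥)
                (absoluteₜ w ρ λ y y∈ → h y (∪⁺ʳ (FvTerm t) (FvTerm s) y∈) ∉⊥)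
      absolute (self-∈ {x}) ρ h =
        -- This formula is its own relativization, so one refutation by foundation settles both
        -- directions.
        mk⇔ (λ p → ⊥-elim (false p)) (λ (_ , p) → ⊥-elim (false p))
        where
        false : ¬ RST⟦ var x ∈̇ var x ⟧ ρ
        false (a , a≐x , a∈x) = ε-irrefl _ (proj₂ a≐x a∈x)
      absolute (var-= {x} {t} v x∉t) ρ h =
        mk⇔ (λ p → in-⁅⁆ (value-in v ρ k p) , to abs p)
            (λ (_ , p) → from abs p)
        where
        k : ρ In FvTerm t
        k y y∈ = h y (∪⁺ʳ ⁅ x ⁆ (FvTerm t) y∈) (∉⇒∉⁅⁆ x∉t y∈)
        abs = absolute-= {t = var x} {t} (id , id) (absoluteₜ v ρ k)
      absolute (=-var {x} {t} v x∉t) ρ h =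
        mk⇔ (λ p → in-⁅⁆ (value-in v ρ k (≐-sym p)) , to abs p)
            (λ (_ , p) → from abs p)
        where
        k : ρ In FvTerm t
        k y y∈ = h y (∪⁺ˡ (FvTerm t) ⁅ x ⁆ y∈) (∉⇒∉⁅⁆ x∉t y∈)
        abs = absolute-= {t = t} {var x} (absoluteₜ v ρ k) (id , id)
      absolute (var-∈ {x} {t} v x∉t) ρ h =
        mk⇔ (λ p@(a , a≐x , a∈t) →
               in-⁅⁆ (member-in v ρ k (subst (RST⟦ t ⟧ₜ ρ) (≐⇒≡ a≐x) a∈t)) , to abs p)
            (λ (_ , p) → from abs p)
        where
        k : ρ In FvTerm t
        k y y∈ = h y (∪⁺ʳ ⁅ x ⁆ (FvTerm t) y∈) (∉⇒∉⁅⁆ x∉t y∈)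
        abs = absolute-∈ {t = var x} {t} (id , id) (absoluteₜ v ρ k)
      absolute (neg p) ρ h =
        mk⇔ (λ ¬φ → vacuous , λ φᴹ → ¬φ (from abs (vacuous , φᴹ)))
            (λ (_ , ¬φᴹ) φ → ¬φᴹ (proj₂ (to abs φ)))
        where abs = absolute p ρ h
      absolute (or {φ} {ψ} p q) ρ h =
        mk⇔ [ (λ r → map₂ inj₁ (to absˡ r)) , (λ r → map₂ inj₂ (to absʳ r)) ]
            (λ (i , r) → Sum.map (λ r → from absˡ (i , r)) (λ r → from absʳ (i , r)) r)
        where
        absˡ = absolute p ρ λ y y∈ → h y (∪⁺ˡ (Fv φ) (Fv ψ) y∈)
        absʳ = absolute q ρ λ y y∈ → h y (∪⁺ʳ (Fv φ) (Fv ψ) y∈)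
      absolute (and {φ} {ψ} {X} {Y} p q disj) ρ h =
        mk⇔ (λ (r , s) → let (i , r′) = to absˡ r
                             (j , s′) = to (absʳ i) s
                         in (λ x x∈ → [ i x , j x ] (x∈p∪q⁻ X Y x∈)) , r′ , s′)
            (λ (i , r , s) → let iX = λ x x∈ → i x (∪⁺ˡ X Y x∈)
                             in from absˡ (iX , r) ,
                                from (absʳ iX) ((λ x x∈ → i x (∪⁺ʳ X Y x∈)) , s))
        where
        -- A variable free in φ is never in Y, so a parameter of φ is outside X ∪ Y and is known to
        -- be in M.
        absˡ : AbsoluteAt φ X ρ
        absˡ = absolute p ρ λ y y∈ y∉X → h y (∪⁺ˡ (Fv φ) (Fv ψ) y∈) λ y∈XY →
          [ y∉X , (λ y∈Y → disj (y , x∈p∩q⁺ (y∈Y , y∈))) ] (x∈p∪q⁻ X Y y∈XY)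

        -- Variables of X may be parameters of ψ. Their values are in M only once φ has put them
        -- there, hence the hypothesis.
        absʳ : ρ In X → AbsoluteAt ψ Y ρ
        absʳ i = absolute q ρ param
          where
          param : ParamsIn ψ Y ρ
          param y y∈ y∉Y with y ∈? X
          ... | yes y∈X = i y y∈X
          ... | no  y∉X = h y (∪⁺ʳ (Fv φ) (Fv ψ) y∈) λ y∈XY →
            [ y∉X , y∉Y ] (x∈p∪q⁻ X Y y∈XY)
      absolute (ex {φ} {X} 0∈X p) ρ h =
        -- Since `zero ∈ X`, absoluteness of φ itself places the witness in M, as the relativized
        -- quantifier requires.
        mk⇔ (λ (a , r) → let (i , r′) = to (abs a) r
                         in (λ x x∈ → i (suc x) (∈-tail⁻ x∈)) , a , i zero 0∈X , r′)
            (λ (i , a , a∈M , r) → a , from (abs a) (in-▹ i a∈M , r))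
        where
        abs : ∀ a → AbsoluteAt φ X (a ▹ ρ)
        abs a = absolute p (a ▹ ρ) (params-▹ {φ = φ} 0∈X h)

        in-▹ : ∀ {a} → ρ In Vec.tail X → a ε̂ M → (a ▹ ρ) In X
        in-▹ i a∈M zero    _  = a∈M
        in-▹ i a∈M (suc x) x∈ = i x (∈-tail⁺ x∈)

  -- Definability

  -- The two environments are related pointwise, a condition that survives extension by a witness
  -- under a quantifier.
  Sat-rename : ∀ {m n} (φ : ∈Formula m) {f : Fin m → Fin n} {ρ ρ′} →
               (∀ i → ρ i ≡ ρ′ (f i)) → Sat φ ρ ⇔ Sat (renameᶻ f φ) ρ′
  Sat-rename (x =̇ y) eq = mk⇔ (subst₂ _≡_ (eq x) (eq y)) (subst₂ _≡_ (sym (eq x)) (sym (eq y)))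
  Sat-rename (x ∈̇ y) eq = mk⇔ (subst₂ _ε_ (eq x) (eq y)) (subst₂ _ε_ (sym (eq x)) (sym (eq y)))
  Sat-rename (¬̇ φ) eq =
    mk⇔ (λ p q → p (from (Sat-rename φ eq) q)) (λ p q → p (to (Sat-rename φ eq) q))
  Sat-rename (φ ∧̇ ψ) eq =
    mk⇔ (Prod.map (to (Sat-rename φ eq)) (to (Sat-rename ψ eq)))
        (Prod.map (from (Sat-rename φ eq)) (from (Sat-rename ψ eq)))
  Sat-rename (φ ∨̇ ψ) eq =
    mk⇔ (Sum.map (to (Sat-rename φ eq)) (to (Sat-rename ψ eq)))
        (Sum.map (from (Sat-rename φ eq)) (from (Sat-rename ψ eq)))
  Sat-rename (∃̇ φ) eq =
    mk⇔ (map₂ (to (Sat-rename φ (▹-cong eq)))) (map₂ (from (Sat-rename φ (▹-cong eq))))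

  -- Links a semantic predicate to a formula without abstracts, the only kind that Replacement
  -- accepts.
  record Definable {n} (P : Vector V n → Set ℓ) : Set ℓ where
    constructor _by_
    field
      formula : ∈Formula n
      defines : ∀ ρ → Sat formula ρ ⇔ P ρ

  open Definable

  respᵈ : ∀ {n} {P Q : Vector V n → Set ℓ} → (∀ ρ → P ρ ⇔ Q ρ) → Definable P → Definable Q
  respᵈ eq (φ by d) = φ by λ ρ → mk⇔ (to (eq ρ) ∘ to (d ρ)) (from (d ρ) ∘ from (eq ρ))

  -- Renaming along `id` carries satisfaction from ρ to ρ′, and a second use at ρ′ alone removes the
  -- renaming.
  Definable-resp-≗ : ∀ {n} {P : Vector V n → Set ℓ} → Definable P →
                     ∀ {ρ ρ′} → ρ ≗ ρ′ → P ρ → P ρ′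
  Definable-resp-≗ (φ by d) {ρ} {ρ′} eq p =
    to (d ρ′) (from (Sat-rename φ {id} (λ _ → refl)) (to (Sat-rename φ {id} eq) (from (d ρ) p)))

  -- Here g is the action of f on environments. Asking for it only pointwise lets g be assembled
  -- from `head`, `tail` and `▹`.
  renameᵈ : ∀ {m n} {P : Vector V m → Set ℓ} (f : Fin m → Fin n) (g : Vector V n → Vector V m) →
            (∀ ρ i → g ρ i ≡ ρ (f i)) → Definable P → Definable (λ ρ → P (g ρ))
  renameᵈ f g eq (φ by d) = renameᶻ f φ by λ ρ →
    mk⇔ (to (d (g ρ)) ∘ from (Sat-rename φ (eq ρ))) (to (Sat-rename φ (eq ρ)) ∘ from (d (g ρ)))

  ≡ᵈ : ∀ {n} (i j : Fin n) → Definable (λ ρ → ρ i ≡ ρ j)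
  ≡ᵈ i j = (i =̇ j) by λ _ → mk⇔ id id

  εᵈ : ∀ {n} (i j : Fin n) → Definable (λ ρ → ρ i ε ρ j)
  εᵈ i j = (i ∈̇ j) by λ _ → mk⇔ id id

  ¬ᵈ : ∀ {n} {P : Vector V n → Set ℓ} → Definable P → Definable (λ ρ → ¬ P ρ)
  ¬ᵈ (φ by d) = (¬̇ φ) by λ ρ → mk⇔ (λ p q → p (from (d ρ) q)) (λ p q → p (to (d ρ) q))

  module _ {n} {P Q : Vector V n → Set ℓ} (dP : Definable P) (dQ : Definable Q) where

    ×ᵈ : Definable (λ ρ → P ρ × Q ρ)
    ×ᵈ = (formula dP ∧̇ formula dQ) by λ ρ →
      mk⇔ (Prod.map (to (defines dP ρ)) (to (defines dQ ρ)))
          (Prod.map (from (defines dP ρ)) (from (defines dQ ρ)))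

    ⊎ᵈ : Definable (λ ρ → P ρ ⊎ Q ρ)
    ⊎ᵈ = (formula dP ∨̇ formula dQ) by λ ρ →
      mk⇔ (Sum.map (to (defines dP ρ)) (to (defines dQ ρ)))
          (Sum.map (from (defines dP ρ)) (from (defines dQ ρ)))

  -- Formulas have only ¬, ∧, ∨ and ∃ as connectives and quantifiers; excluded middle justifies the
  -- classical rendering of implication here and of ∀ below.
  →ᵈ : ∀ {n} {P Q : Vector V n → Set ℓ} → Definable P → Definable Q →
       Definable (λ ρ → P ρ → Q ρ)
  →ᵈ {P = P} {Q} dP dQ = respᵈ classical (⊎ᵈ (¬ᵈ dP) dQ)
    where
    classical : ∀ ρ → (¬ P ρ ⊎ Q ρ) ⇔ (P ρ → Q ρ)
    classical ρ = mk⇔ [ (λ ¬p p → ⊥-elim (¬p p)) , (λ q _ → q) ] decide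
      where
      decide : (P ρ → Q ρ) → ¬ P ρ ⊎ Q ρ
      decide f with em {P ρ}
      ... | yes p = inj₂ (f p)
      ... | no ¬p = inj₁ ¬p

  ⇔ᵈ : ∀ {n} {P Q : Vector V n → Set ℓ} → Definable P → Definable Q →
       Definable (λ ρ → P ρ ⇔ Q ρ)
  ⇔ᵈ dP dQ = respᵈ (λ _ → mk⇔ (λ (f , g) → mk⇔ f g) (λ e → to e , from e))
                   (×ᵈ (→ᵈ dP dQ) (→ᵈ dQ dP))

  Definable₂ : ∀ {n} → (V → Vector V n → Set ℓ) → Set ℓ
  Definable₂ P = Definable λ ρ → P (head ρ) (tail ρ)

  ∃ᵈ : ∀ {n} {P : V → Vector V n → Set ℓ} → Definable₂ P →
       Definable (λ ρ → ∃ λ a → P a ρ)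
  ∃ᵈ (φ by d) = (∃̇ φ) by λ ρ → mk⇔ (map₂ (to (d _))) (map₂ (from (d _)))

  ∀ᵈ : ∀ {n} {P : V → Vector V n → Set ℓ} → Definable₂ P →
       Definable (λ ρ → ∀ a → P a ρ)
  ∀ᵈ {P = P} d = respᵈ classical (¬ᵈ (∃ᵈ (¬ᵈ d)))
    where
    classical : ∀ ρ → (¬ ∃ λ a → ¬ P a ρ) ⇔ (∀ a → P a ρ)
    classical ρ = mk⇔ (λ ¬∃¬ a → decidable-stable em λ ¬p → ¬∃¬ (a , ¬p))
                      (λ f (a , ¬p) → ¬p (f a))

  ≐ᵈ : ∀ {n} {P Q : V → Vector V n → Set ℓ} → Definable₂ P → Definable₂ Q →
       Definable (λ ρ → (λ a → P a ρ) ≐ (λ a → Q a ρ))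
  ≐ᵈ {P = P} {Q} dP dQ = respᵈ pointwise (∀ᵈ (⇔ᵈ dP dQ))
    where
    pointwise : ∀ ρ → (∀ a → P a ρ ⇔ Q a ρ) ⇔ ((λ a → P a ρ) ≐ (λ a → Q a ρ))
    pointwise ρ = mk⇔ (λ e → (λ {a} p → to (e a) p) , (λ {a} q → from (e a) q))
                      (λ e a → mk⇔ (proj₁ e {a}) (proj₂ e {a}))

  pushᵈ : ∀ {n} {P : Vector V (suc n) → Set ℓ} → Definable P → Definable₂ (λ a ρ → P (a ▹ ρ))
  pushᵈ = renameᵈ id (λ ρ → head ρ ▹ tail ρ) λ { _ zero → refl ; _ (suc _) → refl }

  weaken₁ᵈ : ∀ {n} {P : V → Vector V n → Set ℓ} → Definable₂ P →
             Definable₂ (λ a (ρ : Vector V (suc n)) → P a (tail ρ))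
  weaken₁ᵈ = renameᵈ (zero ▹ λ i → suc (suc i)) (λ ρ → head ρ ▹ tail (tail ρ))
               λ { _ zero → refl ; _ (suc _) → refl }

  mutual
    -- Elimination of class terms: a term enters a formula only through the condition it puts on its
    -- members, so abstracts unfold to their bodies and equations to coextensionality.
    ⟦_⟧ₜᵈ : ∀ {n} (t : RSTTerm n) → Definable₂ (λ a ρ → RST⟦ t ⟧ₜ ρ a)
    ⟦ var x ⟧ₜᵈ  = εᵈ zero (suc x)
    ⟦ ｛ φ ｝ ⟧ₜᵈ = pushᵈ ⟦ φ ⟧ᵈ

    ⟦_⟧ᵈ : ∀ {n} (φ : RSTFormula n) → Definable (RST⟦ φ ⟧)
    ⟦ t =̇ s ⟧ᵈ = ≐ᵈ ⟦ t ⟧ₜᵈ ⟦ s ⟧ₜᵈ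
    ⟦ t ∈̇ s ⟧ᵈ =
      ∃ᵈ (×ᵈ (≐ᵈ (εᵈ zero (suc zero)) (weaken₁ᵈ {P = λ a ρ → RST⟦ t ⟧ₜ ρ a} ⟦ t ⟧ₜᵈ)) ⟦ s ⟧ₜᵈ)
    ⟦ ¬̇ φ ⟧ᵈ   = ¬ᵈ ⟦ φ ⟧ᵈ
    ⟦ φ ∧̇ ψ ⟧ᵈ = ×ᵈ ⟦ φ ⟧ᵈ ⟦ ψ ⟧ᵈ
    ⟦ φ ∨̇ ψ ⟧ᵈ = ⊎ᵈ ⟦ φ ⟧ᵈ ⟦ ψ ⟧ᵈ
    ⟦ ∃̇ φ ⟧ᵈ   = ∃ᵈ (pushᵈ ⟦ φ ⟧ᵈ)

  -- Families of sets

  record Family {n} (P : V → Vector V n → Set ℓ) : Set ℓ where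
    field
      definable : Definable₂ P
      isSet     : ∀ ρ → IsSet (λ v → P v ρ)

    resp-≗ : ∀ {v ρ ρ′} → ρ ≗ ρ′ → P v ρ → P v ρ′
    resp-≗ {v} {ρ} {ρ′} eq = Definable-resp-≗ definable {v ▹ ρ} {v ▹ ρ′}
      λ { zero → refl ; (suc i) → eq i }

  open Family

  respᶠ : ∀ {n} {P Q : V → Vector V n → Set ℓ} → (∀ v ρ → P v ρ ⇔ Q v ρ) → Family P → Family Q
  definable (respᶠ eq F) = respᵈ (λ ρ → eq (head ρ) (tail ρ)) (definable F)
  isSet (respᶠ eq F) ρ with isSet F ρ
  ... | b , p , q = b , (λ {v} v∈b → to (eq v ρ) (p v∈b)) , (λ {v} r → q (from (eq v ρ) r))

  renameᶠ : ∀ {m n} {P : V → Vector V m → Set ℓ} (f : Fin m → Fin n) (g : Vector V n → Vector V m) →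
            (∀ ρ i → g ρ i ≡ ρ (f i)) → Family P → Family (λ v ρ → P v (g ρ))
  definable (renameᶠ f g eq F) =
    renameᵈ (lift 1 f) (λ ρ → head ρ ▹ g (tail ρ))
      (λ { ρ zero → refl ; ρ (suc i) → eq (tail ρ) i }) (definable F)
  isSet (renameᶠ f g eq F) ρ = isSet F (g ρ)

  ⊎ᶠ : ∀ {n} {P Q : V → Vector V n → Set ℓ} → Family P → Family Q →
       Family (λ v ρ → P v ρ ⊎ Q v ρ)
  definable (⊎ᶠ F G) = ⊎ᵈ (definable F) (definable G)
  isSet (⊎ᶠ F G) ρ with isSet F ρ | isSet G ρ
  ... | a , p , p′ | b , q , q′ with pairing a b
  ... | c , c-pair with union c
  ... | u , u-union = u , fwd , bwd
    where
    fwd : ∀ {v} → v ε u → _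
    fwd v∈u with to (u-union _) v∈u
    ... | d , d∈c , v∈d with to (c-pair d) d∈c
    ... | inj₁ refl = inj₁ (p v∈d)
    ... | inj₂ refl = inj₂ (q v∈d)

    bwd : ∀ {v} → _ → v ε u
    bwd (inj₁ r) = from (u-union _) (a , from (c-pair a) (inj₁ refl) , p′ r)
    bwd (inj₂ r) = from (u-union _) (b , from (c-pair b) (inj₂ refl) , q′ r)

  ∅-isSet : {P : Pred V ℓ} → (∀ v → ¬ P v) → IsSet P
  ∅-isSet ¬P with empty
  ... | e , e-empty = e , (λ v∈e → ⊥-elim (e-empty _ v∈e)) , (λ p → ⊥-elim (¬P _ p))

  singleton-isSet : ∀ a → IsSet (_≡ a)
  singleton-isSet a with pairing a a
  ... | b , b-pair = b , (λ v∈b → [ id , id ] (to (b-pair _) v∈b)) ,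
                         (λ v≡a → from (b-pair _) (inj₁ v≡a))

  -- R does not depend on v, so at each ρ the set is either unchanged or empty, and excluded middle
  -- decides which.
  restrictᶠ : ∀ {n} {R : Vector V n → Set ℓ} {P : V → Vector V n → Set ℓ} →
              Definable R → Family P → Family (λ v ρ → R ρ × P v ρ)
  definable (restrictᶠ d F) = ×ᵈ (renameᵈ suc tail (λ _ _ → refl) d) (definable F)
  isSet (restrictᶠ {R = R} d F) ρ with em {R ρ}
  ... | no ¬r = ∅-isSet λ _ (r , _) → ¬r r
  ... | yes r with isSet F ρ
  ... | b , p , q = b , (λ v∈b → r , p v∈b) , (λ (_ , s) → q s)

  module _ {n} {Q : V → Vector V n → Set ℓ} {P : V → Vector V (suc n) → Set ℓ}
           (F : Family Q) (G : Family P) where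

    -- The functional relation given to Replacement: b is the set that G provides at `a ▹ ρ`.
    Values : V → V → Vector V n → Set ℓ
    Values a b ρ = ∀ v → v ε b ⇔ P v (a ▹ ρ)

    Values-definable : Definable {suc (suc n)} (λ ρ → Values (head ρ) (head (tail ρ)) (tail (tail ρ)))
    Values-definable = ∀ᵈ (⇔ᵈ (εᵈ zero (suc (suc zero)))
      (renameᵈ (zero ▹ suc zero ▹ λ i → suc (suc (suc i)))
        (λ ρ → head ρ ▹ head (tail ρ) ▹ tail (tail (tail ρ)))
        (λ { _ zero → refl ; _ (suc zero) → refl ; _ (suc (suc _)) → refl }) (definable G)))

    Values-functional : ∀ {a b b′ ρ} → Values a b ρ → Values a b′ ρ → b ≡ b′
    Values-functional h h′ = ext λ v → mk⇔ (from (h′ v) ∘ to (h v)) (from (h v) ∘ to (h′ v))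

    -- Replacement maps the set of all a satisfying Q to the set of the corresponding sets of v; the
    -- union of that image is the required set.
    bindᶠ : Family (λ v ρ → ∃ λ a → Q a ρ × P v (a ▹ ρ))
    definable bindᶠ = ∃ᵈ (×ᵈ (weaken₁ᵈ {P = Q} (definable F))
      -- The quantified a stands before v in this context, whereas `definable G` takes v first.
      (renameᵈ (suc zero ▹ zero ▹ λ i → suc (suc i))
        (λ ρ → head (tail ρ) ▹ head ρ ▹ tail (tail ρ))
        (λ { _ zero → refl ; _ (suc zero) → refl ; _ (suc (suc _)) → refl }) (definable G)))
    isSet bindᶠ ρ with isSet F ρ
    ... | q , q⇒ , ⇒q with replacement (formula Values-definable) ρ q
                           (λ x y y′ _ h h′ → Values-functional
                             (to (defines Values-definable (x ▹ y ▹ ρ)) h)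
                             (to (defines Values-definable (x ▹ y′ ▹ ρ)) h′))
    ... | r , r-image with union r
    ... | u , u-union = u , fwd , bwd
      where
      fwd : ∀ {v} → v ε u → ∃ λ a → Q a ρ × P v (a ▹ ρ)
      fwd v∈u with to (u-union _) v∈u
      ... | b , b∈r , v∈b with to (r-image b) b∈r
      ... | a , a∈q , h = a , q⇒ a∈q , to (to (defines Values-definable (a ▹ b ▹ ρ)) h _) v∈b

      bwd : ∀ {v} → (∃ λ a → Q a ρ × P v (a ▹ ρ)) → v ε u
      bwd (a , qa , pv) with isSet G (a ▹ ρ)
      ... | b , b⇒ , ⇒b = from (u-union _) (b , from (r-image b) (a , ⇒q qa ,
        from (defines Values-definable (a ▹ b ▹ ρ)) (λ v → mk⇔ b⇒ ⇒b)) , ⇒b pv)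

  -- Definable maps and tuples

  DefinableMap : ∀ {n} → (Vector V n → V) → Set ℓ
  DefinableMap f = Definable₂ (λ v ρ → v ≡ f ρ)

  singletonᶠ : ∀ {n} {f : Vector V n → V} → DefinableMap f → Family (λ v ρ → v ≡ f ρ)
  definable (singletonᶠ d) = d
  isSet (singletonᶠ {f = f} d) ρ = singleton-isSet (f ρ)

  -- By extensionality a value of f is determined by its members, so defining membership in it
  -- defines the graph of f.
  ≡-extᵈ : ∀ {n} {f : Vector V n → V} {P : V → Vector V n → Set ℓ} →
           (∀ ρ w → w ε f ρ ⇔ P w ρ) → Definable₂ P → DefinableMap f
  ≡-extᵈ {f = f} {P} spec d = respᵈ eq (∀ᵈ (⇔ᵈ (εᵈ zero (suc zero)) (weaken₁ᵈ {P = P} d)))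
    where
    eq : ∀ ρ → (∀ w → w ε head ρ ⇔ P w (tail ρ)) ⇔ (head ρ ≡ f (tail ρ))
    eq ρ = mk⇔ (λ h → ext λ w → mk⇔ (from (spec (tail ρ) w) ∘ to (h w))
                                     (from (h w) ∘ to (spec (tail ρ) w)))
               (λ h w → subst (λ a → w ε a ⇔ P w (tail ρ)) (sym h) (spec (tail ρ) w))

  upairᵈ : ∀ {n} {f g : Vector V n → V} → DefinableMap f → DefinableMap g →
           DefinableMap (λ ρ → upair (f ρ) (g ρ))
  upairᵈ {f = f} {g} d e = ≡-extᵈ (λ ρ → proj₂ (pairing (f ρ) (g ρ))) (⊎ᵈ d e)

  opairᵈ : ∀ {n} {f g : Vector V n → V} → DefinableMap f → DefinableMap g →
           DefinableMap (λ ρ → opair (f ρ) (g ρ))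
  opairᵈ {f = f} {g} d e =
    upairᵈ {f = λ ρ → upair (f ρ) (f ρ)} {λ ρ → upair (f ρ) (g ρ)}
      (upairᵈ {f = f} {f} d d) (upairᵈ {f = f} {g} d e)

  -- The accumulator grows along the list, so the induction needs an arbitrary definable map as its
  -- start.
  foldl-opairᵈ : ∀ {n} {f : Vector V n → V} → DefinableMap f → (xs : List (Fin n)) →
                 DefinableMap (λ ρ → List.foldl opair (f ρ) (List.map ρ xs))
  foldl-opairᵈ d []       = d
  foldl-opairᵈ {f = f} d (x ∷ xs) =
    foldl-opairᵈ {f = λ ρ → opair (f ρ) (ρ x)} (opairᵈ {f = f} {λ ρ → ρ x} d (≡ᵈ zero (suc x))) xs

  tupleᵈ : ∀ {n} (xs : List (Fin n)) → DefinableMap (λ ρ → tuple (List.map ρ xs))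
  -- The empty set is described by the condition w ≠ w, which no w satisfies.
  tupleᵈ []       = ≡-extᵈ {P = λ w _ → ¬ w ≡ w}
    (λ _ w → mk⇔ (λ w∈ → ⊥-elim (proj₂ empty w w∈)) (λ w≢w → ⊥-elim (w≢w refl)))
    (¬ᵈ (≡ᵈ zero zero))
  tupleᵈ (x ∷ xs) = foldl-opairᵈ {f = λ ρ → ρ x} (≡ᵈ zero (suc x)) xs

  -- The invariant for each form of safe formula

  Collect : ∀ {n} → RSTFormula n → Subset n → (V → Vector V n → Set ℓ) → V → Vector V n → Set ℓ
  Collect φ X P v ρ = ∃ λ τ → τ ≈[ X ] ρ × RST⟦ φ ⟧ τ × P v τ

  -- All families P are allowed because conjunction applies the invariant of φ to a family already
  -- collected along ψ.
  Collects : ∀ {n} → RSTFormula n → Subset n → Set (lsuc ℓ)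
  Collects {n} φ X = ∀ {P : V → Vector V n → Set ℓ} → Family P → Family (Collect φ X P)

  -- Nothing may change, so τ is ρ up to pointwise equality and φ merely restricts P.
  collect-∅ : ∀ {n} (φ : RSTFormula n) → Collects φ ∅
  collect-∅ φ {P} F = respᶠ eq (restrictᶠ ⟦ φ ⟧ᵈ F)
    where
    eq : ∀ v ρ → (RST⟦ φ ⟧ ρ × P v ρ) ⇔ Collect φ ∅ P v ρ
    eq v ρ = mk⇔ (λ (p , q) → ρ , (λ _ _ → refl) , p , q)
                 (λ (τ , τ≈ρ , p , q) → let τ≗ρ = λ i → τ≈ρ i ∉⊥ in
                    ⟦⟧-resp-≗ φ τ≗ρ p , resp-≗ F τ≗ρ q)

  -- Only the value a of x varies, so collecting is a bind over the set of those a that satisfy φ.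
  collect-⁅⁆ : ∀ {n} (φ : RSTFormula n) x →
               (∀ ρ → IsSet (λ a → RST⟦ φ ⟧ (ρ [ x ≔ a ]))) → Collects φ ⁅ x ⁆
  collect-⁅⁆ {n} φ x φ-set {P} F = respᶠ eq (bindᶠ Q P′)
    where
    Q : Family (λ a ρ → RST⟦ φ ⟧ (ρ [ x ≔ a ]))
    definable Q = renameᵈ (assign x) (λ ρ → tail ρ [ x ≔ head ρ ]) asg ⟦ φ ⟧ᵈ
      where
      asg : ∀ (ρ : Vector V (suc n)) i → (tail ρ [ x ≔ head ρ ]) i ≡ ρ (assign x i)
      asg ρ i with assign x i
      ... | zero  = refl
      ... | suc _ = refl
    isSet Q = φ-set

    P′ : Family (λ v ρ → P v (ρ ∘ assign x))
    P′ = renameᶠ (assign x) (_∘ assign x) (λ _ _ → refl) F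

    eq : ∀ v ρ → (∃ λ a → RST⟦ φ ⟧ (ρ [ x ≔ a ]) × P v (ρ [ x ≔ a ])) ⇔ Collect φ ⁅ x ⁆ P v ρ
    eq v ρ = mk⇔ (λ (a , p , q) → ρ [ x ≔ a ] , agree a , p , q)
                 (λ (τ , τ≈ρ , p , q) → let τ≗ = ≈⁅⁆⇒≔ x τ≈ρ in
                    τ x , ⟦⟧-resp-≗ φ τ≗ p , resp-≗ F τ≗ q)
      where
      agree : ∀ a → ρ [ x ≔ a ] ≈[ ⁅ x ⁆ ] ρ
      agree a y y∉ = ≔-minimal ρ a λ { refl → y∉ (x∈⁅x⁆ x) }

  collect-∨ : ∀ {n} (φ ψ : RSTFormula n) {X} → Collects φ X → Collects ψ X → Collects (φ ∨̇ ψ) X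
  collect-∨ φ ψ {X} c d {P} F = respᶠ eq (⊎ᶠ (c F) (d F))
    where
    eq : ∀ v ρ → (Collect φ X P v ρ ⊎ Collect ψ X P v ρ) ⇔ Collect (φ ∨̇ ψ) X P v ρ
    eq v ρ = mk⇔ [ (λ (τ , e , p , q) → τ , e , inj₁ p , q)
                 , (λ (τ , e , p , q) → τ , e , inj₂ p , q) ]
                 λ { (τ , e , inj₁ p , q) → inj₁ (τ , e , p , q)
                   ; (τ , e , inj₂ p , q) → inj₂ (τ , e , p , q) }

  -- First X is changed to satisfy φ, then Y to satisfy ψ. The second change misses the free
  -- variables of φ and so preserves its truth.
  collect-∧ : ∀ {n} (φ ψ : RSTFormula n) {X Y} → Empty (Y ∩ Fv φ) →
              Collects φ X → Collects ψ Y → Collects (φ ∧̇ ψ) (X ∪ Y)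
  collect-∧ φ ψ {X} {Y} disj c d {P} F = respᶠ eq (c (d F))
    where
    agreeφ : ∀ {τ τ′} → τ ≈[ Y ] τ′ → ∀ i → i ∈ Fv φ → τ i ≡ τ′ i
    agreeφ e i i∈ = e i λ i∈Y → disj (i , x∈p∩q⁺ (i∈Y , i∈))

    eq : ∀ v ρ → Collect φ X (Collect ψ Y P) v ρ ⇔ Collect (φ ∧̇ ψ) (X ∪ Y) P v ρ
    eq v ρ = mk⇔
      (λ (τ , e , p , τ′ , e′ , q , r) →
         τ′ , (λ y y∉ → trans (e′ y (y∉ ∘ ∪⁺ʳ X Y)) (e y (y∉ ∘ ∪⁺ˡ X Y))) ,
         (coincidence (λ ()) φ (λ i i∈ → sym (agreeφ e′ i i∈)) p , q) , r)
      -- Conversely, the intermediate environment takes the values of τ on X and those of ρ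
      -- elsewhere.
      (λ (τ , e , (p , q) , r) → let e′ = splice-∪ X Y τ ρ e in
         splice X τ ρ , splice-≈ X τ ρ , coincidence (λ ()) φ (agreeφ e′) p , τ , e′ , q , r)

  -- As the bound variable belongs to X, its initial value b is irrelevant; b = v
  -- gives definability without a constant.
  collect-∃ : ∀ {n} (φ : RSTFormula (suc n)) {X} → zero ∈ X → Collects φ X →
              Collects (∃̇ φ) (Vec.tail X)
  collect-∃ {n} φ {X} 0∈X c {P} F = record
    { definable = respᵈ (λ ρ → eq (head ρ) (head ρ) (tail ρ))
        (renameᵈ (zero ▹ zero ▹ suc) (λ ρ → head ρ ▹ head ρ ▹ tail ρ)
          (λ { _ zero → refl ; _ (suc zero) → refl ; _ (suc (suc _)) → refl }) (definable G))
    ; isSet = λ ρ → let (b , p , q) = isSet G (proj₁ empty ▹ ρ) in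
        b , (λ {v} v∈b → to (eq v _ ρ) (p v∈b)) , (λ {v} r → q (from (eq v _ ρ) r))
    }
    where
    P′ : V → Vector V (suc n) → Set ℓ
    P′ v ρ = P v (tail ρ)

    G : Family (Collect φ X P′)
    G = c (renameᶠ suc tail (λ _ _ → refl) F)

    agree : ∀ {a b τ ρ} → τ ≈[ Vec.tail X ] ρ → (a ▹ τ) ≈[ X ] (b ▹ ρ)
    agree e zero    y∉ = ⊥-elim (y∉ 0∈X)
    agree e (suc y) y∉ = e y λ y∈ → y∉ (∈-tail⁻ y∈)

    eq : ∀ v b ρ → Collect φ X P′ v (b ▹ ρ) ⇔ Collect (∃̇ φ) (Vec.tail X) P v ρ
    eq v b ρ = mk⇔
      (λ (τ , e , p , q) → tail τ , (λ y y∉ → e (suc y) λ y∈ → y∉ (∈-tail⁺ y∈)) ,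
         (head τ , ⟦⟧-resp-≗ φ (λ { zero → refl ; (suc _) → refl }) p) , q)
      (λ (τ , e , (a , p) , q) → a ▹ τ , agree e , p , q)

  -- Values of valid terms and sets of tuples

  assign-fresh : ∀ {n x} (t : RSTTerm n) → x ∉ FvTerm t → ∀ ρ a →
                 RST⟦ t ⟧ₜ (ρ [ x ≔ a ]) ≐ RST⟦ t ⟧ₜ ρ
  assign-fresh t x∉t ρ a = coincidenceₜ (λ ()) t λ i i∈ → ≔-minimal ρ a λ { refl → x∉t i∈ }

  mutual
    -- Mutual with `collect`: an abstract is a set by the invariant of its body, and the clauses for
    -- x = t and x ∈ t need t to be a set.
    isSetₜ : ∀ {n} {t : RSTTerm n} → ValidTerm t → ∀ ρ → IsSet (RST⟦ t ⟧ₜ ρ)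
    isSetₜ (var x) ρ = ρ x , id , id
    isSetₜ (｛_｝ {φ} p) ρ
      -- The family collected is the value of the bound variable itself. The empty set is a
      -- placeholder, free to change because index zero is in the safe set.
      with isSet (collect p (singletonᶠ (≡ᵈ zero (suc zero)))) (proj₁ empty ▹ ρ)
    ... | b , b⇒ , ⇒b = b , fwd , bwd
      where
      fwd : ∀ {z} → z ε b → RST⟦ φ ⟧ (z ▹ ρ)
      fwd z∈b with b⇒ z∈b
      ... | τ , e , p , refl =
        ⟦⟧-resp-≗ φ (λ { zero → refl ; (suc i) → e (suc i) λ { (there i∈) → ∉⊥ i∈ } }) p

      bwd : ∀ {z} → RST⟦ φ ⟧ (z ▹ ρ) → z ε b
      bwd {z} p = ⇒b (z ▹ ρ , (λ { zero 0∉ → ⊥-elim (0∉ (x∈⁅x⁆ zero)) ; (suc _) _ → refl }) , p , refl)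

    -- As x is not free in t, updating x leaves the value of t fixed, and that value is the one
    -- solution.
    solution-isSet : ∀ {n} {t : RSTTerm n} {x} → ValidTerm t → x ∉ FvTerm t → ∀ ρ →
                     IsSet (λ a → (_ε (ρ [ x ≔ a ]) x) ≐ RST⟦ t ⟧ₜ (ρ [ x ≔ a ]))
    solution-isSet {t = t} {x} v x∉t ρ with isSetₜ v ρ
    ... | b , b≐t with singleton-isSet b
    ... | c , c⇒ , ⇒c = c , fwd , bwd
      where
      fwd : ∀ {a} → a ε c → _
      fwd {a} a∈c = ≐-trans (≡⇒≐ (trans (≔-updates ρ x a) (c⇒ a∈c)))
                      (≐-trans b≐t (≐-sym (assign-fresh t x∉t ρ a)))

      bwd : ∀ {a} → _ → a ε c
      bwd {a} e = ⇒c (≐⇒≡ (≐-trans (≡⇒≐ (sym (≔-updates ρ x a)))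
                             (≐-trans e (≐-trans (assign-fresh t x∉t ρ a) (≐-sym b≐t)))))

    collect : ∀ {n} {φ : RSTFormula n} {X} → φ ≻ X → Collects φ X
    collect (atom-= {t} {s} _ _) = collect-∅ (t =̇ s)
    collect (atom-∈ {t} {s} _ _) = collect-∅ (t ∈̇ s)
    collect (self-∈ {x}) = collect-⁅⁆ (var x ∈̇ var x) x λ ρ →
      ∅-isSet λ _ (a , a≐x , a∈x) → ε-irrefl _ (proj₂ a≐x a∈x)
    collect (var-= {x} {t} v x∉t) = collect-⁅⁆ (var x =̇ t) x (solution-isSet v x∉t)
    collect (=-var {x} {t} v x∉t) = collect-⁅⁆ (t =̇ var x) x λ ρ →
      let (b , p , q) = solution-isSet v x∉t ρ in b , (≐-sym ∘ p) , (q ∘ ≐-sym)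
    collect (var-∈ {x} {t} v x∉t) = collect-⁅⁆ (var x ∈̇ t) x elements
      where
      elements : ∀ ρ → IsSet (λ a → RST⟦ var x ∈̇ t ⟧ (ρ [ x ≔ a ]))
      elements ρ with isSetₜ v ρ
      ... | b , b⇒ , ⇒b = b , fwd , bwd
        where
        fwd : ∀ {a} → a ε b → RST⟦ var x ∈̇ t ⟧ (ρ [ x ≔ a ])
        fwd {a} a∈b = a , ≡⇒≐ (sym (≔-updates ρ x a)) , proj₂ (assign-fresh t x∉t ρ a) (b⇒ a∈b)

        bwd : ∀ {a} → RST⟦ var x ∈̇ t ⟧ (ρ [ x ≔ a ]) → a ε b
        bwd {a} (a′ , e , a′∈t) with trans (≐⇒≡ e) (≔-updates ρ x a)
        ... | refl = ⇒b (proj₁ (assign-fresh t x∉t ρ a) a′∈t)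
    collect (neg {φ} p) = collect-∅ (¬̇ φ)
    collect (or {φ} {ψ} p q) = collect-∨ φ ψ (collect p) (collect q)
    collect (and {φ} {ψ} p q disj) = collect-∧ φ ψ disj (collect p) (collect q)
    collect (ex {φ} 0∈X p) = collect-∃ φ 0∈X (collect p)

  -- `Tuples` is `Collect` for the graph of the tuple map, once absence from the list xs is
  -- exchanged for absence from X.
  tuples-isSet : ∀ {n} {φ : RSTFormula n} {X} → φ ≻ X → ∀ xs → Enumerates xs X →
                 ∀ ρ → IsSet (Tuples φ xs ρ)
  tuples-isSet p xs (_ , enum) ρ with isSet (collect p (singletonᶠ (tupleᵈ xs))) ρ
  ... | b , b⇒ , ⇒b =
    b , (λ z∈b → map₂ (λ (e , q) → (λ y y∉ → e y (y∉ ∘ to (enum y))) , q) (b⇒ z∈b))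
      , (λ (τ , e , q) → ⇒b (τ , (λ y y∉ → e y (y∉ ∘ from (enum y))) , q))

theorem3 : ∀ {ℓ : Level} → ExcludedMiddle ℓ → (𝔙 : ZFModel ℓ) →
    (∀ {n : ℕ} {t : RSTTerm n} → ValidTerm t → ZFModel.AbsoluteTerm 𝔙 t) ×
    (∀ {n : ℕ} {φ : RSTFormula n} {X : Subset n} → ValidFormula φ → φ ≻ X → ZFModel.AbsoluteFor 𝔙 φ X)
theorem3 em 𝔙 =
  (λ v M 𝔐 → absoluteₜ em 𝔙 𝔐 v) ,
  (λ _ p → record { free     = ≻⇒⊆Fv p
                  ; isSet    = tuples-isSet em 𝔙 p
                  ; absolute = λ M 𝔐 → absolute em 𝔙 𝔐 p })
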